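{- Let $H\subsetneq\mathbb{N}$ be an Arf numerical semigroup written as $$H=\{h_0=0,h_1,\dots,h_n,\rightarrow\}=\{0,x_1,x_1+x_2,\dots,x_1+\dots+x_n,\rightarrow\}$$ with positive integers $x_1,\dots,x_n$ and $h_j=x_1+\dots+x_j$ for all $j\in\{1,\dots,n\}$. Let $i\in\{1,\dots,n\}$, so that $h_i\in H$ is a nonzero element with $h_i\le \mathrm{F}(H)+1$. Then $h_i$ is in the minimal Arf system of generators of $H$ if and only if $x_j\ne x_{j+1}+\dots+x_i$ for all $j$ with $1\le j<i$.
   Context: $\mathbb{N}$ is the set of non-negative integers. A numerical semigroup is a subset $H\subseteq\mathbb{N}$ that contains $0$, is closed under addition, and has finite complement in $\mathbb{N}$. It is Arf if $2a-b\in H$ for all $a,b\in H$ with $a\ge b$. The Frobenius number $\mathrm{F}(H)$ is the largest element of $\mathbb{N}\setminus H$. The notation $H=\{h_0=0,h_1,\dots,h_n,\rightarrow\}$ means that $h_0<h_1<\dots<h_n$ are the elements of $H$ up to its conductor $h_n=\mathrm{F}(H)+1$, listed increasingly, and that every integer larger than $h_n$ is in $H$; thus $x_j=h_j-h_{j-1}$. (It is known that a set of this form, with $x_j$ positive integers, is an Arf numerical semigroup if and only if $x_j\in\{x_{j+1},x_{j+1}+x_{j+2},\dots,x_{j+1}+\dots+x_n,\rightarrow\}$ for all $j\in\{1,\dots,n\}$, where "$\rightarrow$" means that all larger integers are included.) For $X\subset\mathbb{N}$ with $\gcd(X)=1$, $\langle X\rangle$ is the submonoid of $\mathbb{N}$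 generated by $X$ and $\mathrm{Arf}(\langle X\rangle)$ (the Arf closure) is the smallest Arf numerical semigroup, with respect to inclusion, containing $\langle X\rangle$. $X$ is an Arf system of generators of $H$ if $\mathrm{Arf}(\langle X\rangle)=H$, and it is minimal if no proper subset of $X$ is an Arf system of generators of $H$. It is known that every Arf numerical semigroup has a unique minimal Arf system of generators. -}

module Defs where

open import Level using (0ℓ)
open import Data.Nat using (ℕ; suc; _+_; _*_; _∸_; _≤_; _<_)
open import Data.Nat.Divisibility using (_∣_)
open import Data.Nat.ListAction using (sum)
open import Data.List.Base using (List; applyUpTo)
import Data.List.Membership.Propositional as List
open import Data.Product using (_×_; ∃-syntax)
open import Data.Sum using (_⊎_)
open import Relation.Nullary using (¬_)
open import Relation.Unary using (Pred; _∈_; _∉_; _⊆_; _⊂_; _≐_)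
open import Relation.Binary.PropositionalEquality using (_≡_)

-- Subsets of ℕ are arbitrary, not necessarily decidable, predicates.
Subset : Set₁
Subset = Pred ℕ 0ℓ

-- Positive form of "every element of ℕ ∖ H is listed in C"; asking only that
-- m ∉ H implies m ∈ C would be constructively weaker.
FiniteComplement : Subset → Set
FiniteComplement H = ∃[ C ] (∀ m → m ∈ H ⊎ m List.∈ C)

record IsNumericalSemigroup (H : Subset) : Set where
  field
    zero-mem         : 0 ∈ H
    +-closed         : ∀ {a b} → a ∈ H → b ∈ H → a + b ∈ H
    finiteComplement : FiniteComplement H

record IsArf (H : Subset) : Set where
  field
    isNumericalSemigroup : IsNumericalSemigroup H
    arf-closed           : ∀ {a b} → a ∈ H → b ∈ H → b ≤ a → 2 * a ∸ b ∈ H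

IsFrobeniusNumber : Subset → ℕ → Set
IsFrobeniusNumber H f = f ∉ H × (∀ {m} → m ∉ H → m ≤ f)

-- sumIoc x j i = x_{j+1} + ⋯ + x_i for j ≤ i.  Sequences are indexed from 1.
sumIoc : (ℕ → ℕ) → ℕ → ℕ → ℕ
sumIoc x j i = sum (applyUpTo (λ k → x (suc j + k)) (i ∸ j))

-- h x j is h_j = x_1 + ⋯ + x_j; in particular h x 0 = 0.
h : (ℕ → ℕ) → ℕ → ℕ
h x j = sumIoc x 0 j

-- H = {0, x_1, x_1 + x_2, …, x_1 + ⋯ + x_n, →} with x_1, …, x_n positive and
-- x_1 + ⋯ + x_n = F(H) + 1.  Only the values x 1, …, x n matter.  The last
-- condition excludes H = ℕ, which has no Frobenius number in ℕ.
record IsPresentation (H : Subset) (n : ℕ) (x : ℕ → ℕ) : Set where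
  field
    positive  : ∀ j → 1 ≤ j → j ≤ n → 0 < x j
    elements  : H ≐ (λ m → (∃[ j ] (j ≤ n × m ≡ h x j)) ⊎ h x n < m)
    conductor : ∃[ f ] (IsFrobeniusNumber H f × h x n ≡ suc f)

data ⟨_⟩ (X : Subset) : Subset where
  gen      : ∀ {a} → a ∈ X → ⟨ X ⟩ a
  zero-mem : ⟨ X ⟩ 0
  +-closed : ∀ {a b} → ⟨ X ⟩ a → ⟨ X ⟩ b → ⟨ X ⟩ (a + b)

IsGCD : Subset → ℕ → Set
IsGCD X g = (∀ {a} → a ∈ X → g ∣ a) × (∀ d → (∀ {a} → a ∈ X → d ∣ a) → d ∣ g)

-- The relation "Arf(A) = H": H is the smallest Arf numerical semigroup
-- containing A.
record IsArfClosure (A H : Subset) : Set₁ where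
  field
    isArf    : IsArf H
    contains : A ⊆ H
    smallest : ∀ (K : Subset) → IsArf K → A ⊆ K → H ⊆ K

record IsArfSystem (X H : Subset) : Set₁ where
  field
    gcd≡1      : IsGCD X 1
    arfClosure : IsArfClosure ⟨ X ⟩ H

record IsMinimalArfSystem (X H : Subset) : Set₁ where
  field
    isArfSystem : IsArfSystem X H
    minimal     : ∀ (Y : Subset) → Y ⊂ X → ¬ IsArfSystem Y H

{-# OPTIONS --safe #-}

-- Both directions test the minimality of Arf(⟨M⟩) = H on a well-chosen Arf set.
--
-- If x_j = x_{j+1} + ⋯ + x_i, then h_i = 2h_j − h_{j−1}.  Given an Arf-closed P
-- containing M ∖ {h_i}, the Arf semigroup P ∪ [h_i, →) contains M, hence H, so P
-- contains h_j and h_{j−1}, and therefore h_i: the generator h_i is redundant.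
--
-- Conversely, if no such j exists, then H ∖ {h_i} is Arf: a relation
-- h_i + h_l = a + b with a, b ∈ H strictly between h_l and h_i propagates from
-- l to l + 1, until it gives x_j = x_{j+1} + ⋯ + x_i for some j.
module Submission where

open import Defs
open import Data.Nat using (ℕ; _≤_; _<_)
open import Function.Bundles using (_⇔_)
open import Relation.Unary using (U; _∈_; _⊂_)
open import Relation.Binary.PropositionalEquality using (_≢_)

open import Data.Empty using (⊥)
open import Data.List.Base using (applyUpTo; upTo; _∷_)
open import Data.List.Membership.Propositional.Properties using (∈-upTo⁺)
open import Data.List.Relation.Unary.Any using (here; there)
open import Data.Nat using (zero; suc; z≤n; s≤s; s≤s⁻¹; _+_; _*_; _∸_; _≟_; _≤?_)
open import Data.Nat.Divisibility
  using (_∣_; 1∣_; _∣0; ∣m∣n⇒∣m+n; ∣m+n∣m⇒∣n; ∣n⇒∣m*n)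
open import Data.Nat.Induction using (<-rec)
open import Data.Nat.ListAction using (sum)
open import Data.Nat.Properties
open import Data.Nat.Tactic.RingSolver using (solve-∀)
open import Data.Product using (_×_; _,_; proj₁; proj₂)
open import Data.Sum using (_⊎_; inj₁; inj₂)
open import Function.Base using (_∘_)
open import Function.Bundles using (mk⇔)
open import Relation.Binary.PropositionalEquality
  using (_≡_; refl; sym; trans; cong; subst; module ≡-Reasoning)
open import Relation.Nullary using (yes; no; contradiction)
open import Relation.Unary using (_⊆_)

-- Arf-closed sets, cofinite or not.

record IsArfClosed (P : Subset) : Set where
  field
    0-mem      : 0 ∈ P
    sum-closed : ∀ {a b} → a ∈ P → b ∈ P → a + b ∈ P
    arf-closed : ∀ {a b} → a ∈ P → b ∈ P → b ≤ a → 2 * a ∸ b ∈ P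

isArf⇒isArfClosed : ∀ {K} → IsArf K → IsArfClosed K
isArf⇒isArfClosed K-arf = record
  { 0-mem      = IsNumericalSemigroup.zero-mem isNumericalSemigroup
  ; sum-closed = IsNumericalSemigroup.+-closed isNumericalSemigroup
  ; arf-closed = arf-closed
  }
  where open IsArf K-arf

-- For d ≠ 1 the complement is infinite; such sets are the reason `IsArfClosed` does not ask for
-- cofiniteness.
multiples-isArfClosed : ∀ d → IsArfClosed (d ∣_)
multiples-isArfClosed d = record
  { 0-mem      = d ∣0
  ; sum-closed = ∣m∣n⇒∣m+n
  ; arf-closed = λ {a} {b} d∣a d∣b b≤a →
      ∣m+n∣m⇒∣n (subst (d ∣_) (sym (m+[n∸m]≡n (≤-trans b≤a (m≤m+n a _))))
                   (∣n⇒∣m*n 2 d∣a)) d∣b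
  }

2*[m+n]∸m : ∀ m n → 2 * (m + n) ∸ m ≡ m + n + n
2*[m+n]∸m m n = trans (cong (_∸ m) (lemma m n)) (m+n∸m≡n m (m + n + n))
  where
  lemma : ∀ m n → 2 * (m + n) ≡ m + (m + n + n)
  lemma = solve-∀

m≤2*m∸n : ∀ {m n} → n ≤ m → m ≤ 2 * m ∸ n
m≤2*m∸n {m} {n} n≤m = begin
  m              ≡⟨ m+n∸m≡n m m ⟨
  m + m ∸ m      ≤⟨ ∸-monoʳ-≤ (m + m) n≤m ⟩
  m + m ∸ n      ≡⟨ cong (λ k → m + k ∸ n) (+-identityʳ m) ⟨
  2 * m ∸ n      ∎
  where open ≤-Reasoning

-- Adding every integer from `c` on restores cofiniteness and leaves P unchanged below `c`. The
-- added part is stable because a + b and 2a - b are at least a, and a ≥ b in the latter.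
truncate-isArf : ∀ {P} → IsArfClosed P → ∀ c → IsArf (λ m → m ∈ P ⊎ c ≤ m)
truncate-isArf {P} P-closed c = record
  { isNumericalSemigroup = record
      { zero-mem         = inj₁ 0-mem
      ; +-closed         = sums
      ; finiteComplement = upTo c , listed
      }
  ; arf-closed = λ where
      (inj₁ a∈P) (inj₁ b∈P) b≤a → inj₁ (arf-closed a∈P b∈P b≤a)
      (inj₁ _)   (inj₂ c≤b) b≤a → inj₂ (≤-trans (≤-trans c≤b b≤a) (m≤2*m∸n b≤a))
      (inj₂ c≤a) _          b≤a → inj₂ (≤-trans c≤a (m≤2*m∸n b≤a))
  }
  where
  open IsArfClosed P-closed

  sums : ∀ {a b} → a ∈ P ⊎ c ≤ a → b ∈ P ⊎ c ≤ b → a + b ∈ P ⊎ c ≤ a + b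
  sums         (inj₁ a∈P) (inj₁ b∈P) = inj₁ (sum-closed a∈P b∈P)
  sums {a} {b} (inj₁ _)   (inj₂ c≤b) = inj₂ (≤-trans c≤b (m≤n+m b a))
  sums {a} {b} (inj₂ c≤a) _          = inj₂ (≤-trans c≤a (m≤m+n a b))

  listed : ∀ m → (m ∈ P ⊎ c ≤ m) ⊎ _
  listed m with c ≤? m
  ... | yes c≤m = inj₁ (inj₂ c≤m)
  ... | no  c≰m = inj₂ (∈-upTo⁺ (≰⇒> c≰m))

⟨⟩-least : ∀ {X P} → IsArfClosed P → X ⊆ P → ⟨ X ⟩ ⊆ P
⟨⟩-least P-closed X⊆P (gen a∈X)      = X⊆P a∈X
⟨⟩-least P-closed X⊆P zero-mem       = IsArfClosed.0-mem P-closed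
⟨⟩-least P-closed X⊆P (+-closed p q) =
  IsArfClosed.sum-closed P-closed (⟨⟩-least P-closed X⊆P p) (⟨⟩-least P-closed X⊆P q)

-- The Arf property in three elements.

module _ {P : Subset} (P-closed : IsArfClosed P) where
  open IsArfClosed P-closed

  double-closed : ∀ z e → z ∈ P → z + e ∈ P → z + e + e ∈ P
  double-closed z e z∈P z+e∈P =
    subst P (2*[m+n]∸m z e) (arf-closed z+e∈P z∈P (m≤m+n z e))

  -- Subtractive Euclid on (e, d): moving the base from z to z + e turns the
  -- pair (e, e + d′) into (e, d′).
  translate-closed : ∀ z e d → z ∈ P → z + e ∈ P → z + d ∈ P → z + e + d ∈ P
  translate-closed z e d = <-rec Goal step (e + d) z e d refl
    where
    Goal : ℕ → Set
    Goal s = ∀ z e d → e + d ≡ s →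
             z ∈ P → z + e ∈ P → z + d ∈ P → z + e + d ∈ P

    swap : ∀ z e d → z + d + e ≡ z + e + d
    swap = solve-∀

    ordered : ∀ s → (∀ {t} → t < s → Goal t) → ∀ z e d → e ≤ d → e + d ≡ s →
              z ∈ P → z + e ∈ P → z + d ∈ P → z + e + d ∈ P
    ordered s rec z zero d _ _ _ _ z+d∈P =
      subst (λ k → k + d ∈ P) (sym (+-identityʳ z)) z+d∈P
    ordered s rec z e@(suc _) d e≤d refl z∈P z+e∈P z+d∈P =
      subst P (trans (+-assoc (z + e) e (d ∸ e)) (cong (z + e +_) d≡))
        -- The measure e + d drops to d, strictly because `e` is a successor.
        (rec (subst (λ k → k < e + d) (sym d≡) (m<n+m d (s≤s z≤n)))
          (z + e) e (d ∸ e) refl z+e∈P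
          (double-closed z e z∈P z+e∈P)
          (subst P (trans (cong (z +_) (sym d≡)) (sym (+-assoc z e (d ∸ e)))) z+d∈P))
      where
      d≡ : e + (d ∸ e) ≡ d
      d≡ = m+[n∸m]≡n e≤d

    step : ∀ s → (∀ {t} → t < s → Goal t) → Goal s
    step s rec z e d e+d≡s z∈P z+e∈P z+d∈P with ≤-total e d
    ... | inj₁ e≤d = ordered s rec z e d e≤d e+d≡s z∈P z+e∈P z+d∈P
    ... | inj₂ d≤e = subst P (swap z e d)
      (ordered s rec z d e d≤e (trans (+-comm d e) e+d≡s) z∈P z+d∈P z+e∈P)

  -- The classical equivalent of the Arf condition, a + b - c ∈ P, obtained from `translate-closed`
  -- with base `c`.
  +∸-closed : ∀ {a b c} → a ∈ P → b ∈ P → c ∈ P → c ≤ a → c ≤ b → a + (b ∸ c) ∈ P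
  +∸-closed {a} {b} {c} a∈P b∈P c∈P c≤a c≤b =
    subst (λ k → k + (b ∸ c) ∈ P) a≡
      (translate-closed c (a ∸ c) (b ∸ c) c∈P
        (subst P (sym a≡) a∈P) (subst P (sym (m+[n∸m]≡n c≤b)) b∈P))
    where
    a≡ : c + (a ∸ c) ≡ a
    a≡ = m+[n∸m]≡n c≤a

-- Partial sums of x.

sum-applyUpTo-+ : ∀ f m n →
  sum (applyUpTo f (m + n)) ≡ sum (applyUpTo f m) + sum (applyUpTo (f ∘ (m +_)) n)
sum-applyUpTo-+ f zero    n = refl
sum-applyUpTo-+ f (suc m) n =
  trans (cong (f 0 +_) (sum-applyUpTo-+ (f ∘ suc) m n)) (sym (+-assoc (f 0) _ _))

module _ (x : ℕ → ℕ) where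

  h-+ : ∀ {j i} → j ≤ i → h x i ≡ h x j + sumIoc x j i
  h-+ {j} {i} j≤i =
    trans (cong (h x) (sym (m+[n∸m]≡n j≤i))) (sum-applyUpTo-+ (x ∘ suc) j (i ∸ j))

  h-suc : ∀ j → h x (suc j) ≡ h x j + x (suc j)
  h-suc j = begin
    h x (suc j)            ≡⟨ cong (h x) (+-comm j 1) ⟨
    h x (j + 1)            ≡⟨ sum-applyUpTo-+ (x ∘ suc) j 1 ⟩
    h x j + (x (suc (j + 0)) + 0)
      ≡⟨ cong (h x j +_) (trans (+-identityʳ _) (cong (x ∘ suc) (+-identityʳ j))) ⟩
    h x j + x (suc j)      ∎
    where open ≡-Reasoning

  h-mono-≤ : ∀ {j i} → j ≤ i → h x j ≤ h x i
  h-mono-≤ {j} j≤i = subst (h x j ≤_) (sym (h-+ j≤i)) (m≤m+n _ _)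

-- Elements of H in increasing order, and Arf systems of generators of H.

module Presented {H : Subset} (H-arf : IsArf H) {n : ℕ} {x : ℕ → ℕ}
                 (pres : IsPresentation H n x) where
  open IsPresentation pres

  H-closed : IsArfClosed H
  H-closed = isArf⇒isArfClosed H-arf

  h∈H : ∀ {j} → j ≤ n → h x j ∈ H
  h∈H j≤n = proj₂ elements (inj₁ (_ , j≤n , refl))

  h<h-suc : ∀ {j} → j < n → h x j < h x (suc j)
  h<h-suc {j} j<n =
    subst (h x j <_) (sym (h-suc x j)) (m<m+n (h x j) (positive (suc j) (s≤s z≤n) j<n))

  h-mono-< : ∀ {j i} → j < i → i ≤ n → h x j < h x i
  h-mono-< j<i i≤n = <-≤-trans (h<h-suc (≤-trans j<i i≤n)) (h-mono-≤ x j<i)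

  next : ∀ {l a} → l < n → a ∈ H → h x l < a → h x (suc l) ≤ a
  next {l} l<n a∈H hl<a with proj₁ elements a∈H
  ... | inj₂ hn<a = ≤-trans (h-mono-≤ x l<n) (<⇒≤ hn<a)
  ... | inj₁ (j , _ , refl) with suc l ≤? j
  ...   | yes l<j = h-mono-≤ x l<j
  ...   | no  l≮j = contradiction (h-mono-≤ x (s≤s⁻¹ (≰⇒> l≮j))) (<⇒≱ hl<a)

  module _ {M : Subset} (M-sys : IsArfSystem M H) where
    open IsArfSystem M-sys
    open IsArfClosure arfClosure using (contains; smallest)

    M⊆H : M ⊆ H
    M⊆H = contains ∘ gen

    least : ∀ {K} → IsArf K → M ⊆ K → H ⊆ K
    least K-arf M⊆K = smallest _ K-arf (⟨⟩-least (isArf⇒isArfClosed K-arf) M⊆K)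

    module _ {i} (i≤n : i ≤ n) where

      M∖hᵢ : Subset
      M∖hᵢ m = m ∈ M × m ≢ h x i

      -- Redundancy of h_i when the equality holds.

      module Redundant {j} (sj<i : suc j < i) (xj≡ : x (suc j) ≡ sumIoc x (suc j) i) where

        -- The index in the equality is `suc j`; the right side is 2h_{j+1} - h_j in the shape that
        -- `double-closed` produces.
        hᵢ≡ : h x i ≡ h x j + x (suc j) + x (suc j)
        hᵢ≡ = begin
          h x i                                ≡⟨ h-+ x (<⇒≤ sj<i) ⟩
          h x (suc j) + sumIoc x (suc j) i     ≡⟨ cong (h x (suc j) +_) xj≡ ⟨
          h x (suc j) + x (suc j)              ≡⟨ cong (_+ x (suc j)) (h-suc x j) ⟩
          h x j + x (suc j) + x (suc j)        ∎
          where open ≡-Reasoning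

        -- Cofiniteness of P is not assumed, so this serves both the minimality of the closure and,
        -- with the multiples of d, the gcd condition.
        M⊆ : ∀ {P} → IsArfClosed P → M∖hᵢ ⊆ P → M ⊆ P
        M⊆ {P} P-closed Y⊆P = M⊆P
          where
          M⊆trunc : M ⊆ (λ m → m ∈ P ⊎ h x i ≤ m)
          M⊆trunc {m} m∈M with m ≟ h x i
          ... | yes m≡ = inj₂ (≤-reflexive (sym m≡))
          ... | no  m≢ = inj₁ (Y⊆P (m∈M , m≢))

          -- The truncation of P at h_i is an Arf semigroup containing M, hence H, and below h_i it
          -- agrees with P.
          below∈P : ∀ {k} → k < i → h x k ∈ P
          below∈P k<i
            with least (truncate-isArf P-closed (h x i)) M⊆trunc
                   (h∈H (≤-trans (<⇒≤ k<i) i≤n))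
          ... | inj₁ hk∈P  = hk∈P
          ... | inj₂ hi≤hk = contradiction hi≤hk (<⇒≱ (h-mono-< k<i i≤n))

          hᵢ∈P : h x i ∈ P
          hᵢ∈P = subst P (sym hᵢ≡)
            (double-closed P-closed (h x j) (x (suc j)) (below∈P (<⇒≤ sj<i))
              (subst P (h-suc x j) (below∈P sj<i)))

          M⊆P : M ⊆ P
          M⊆P {m} m∈M with m ≟ h x i
          ... | yes m≡ = subst P (sym m≡) hᵢ∈P
          ... | no  m≢ = Y⊆P (m∈M , m≢)

        isArfSystem : IsArfSystem M∖hᵢ H
        isArfSystem = record
          { gcd≡1 = (λ _ → 1∣ _) ,
                    (λ d d∣Y → proj₂ gcd≡1 d (M⊆ (multiples-isArfClosed d) d∣Y))
          ; arfClosure = record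
              { isArf    = H-arf
              ; contains = ⟨⟩-least H-closed (M⊆H ∘ proj₁)
              ; smallest = λ K K-arf Y⊆K →
                  least K-arf (M⊆ (isArf⇒isArfClosed K-arf) (Y⊆K ∘ gen))
              }
          }

      -- Necessity of h_i when no equality holds.

      module Irredundant (x≢ : ∀ j → 1 ≤ j → j < i → x j ≢ sumIoc x j i) where

        hᵢ≢ : ∀ {l} → suc l < i → h x (suc l) + x (suc l) ≢ h x i
        hᵢ≢ {l} sl<i eq = x≢ (suc l) (s≤s z≤n) sl<i
          (+-cancelˡ-≡ (h x (suc l)) _ _ (trans eq (h-+ x (<⇒≤ sl<i))))

        -- Induction on k = i - l. With c = h_{l+1} and d = x_{l+1}, the Arf property puts y = a + b
        -- - c and c + d = 2h_{l+1} - h_l in H, and the relation becomes y + (c + d) = h_i + c. This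
        -- is the relation at l + 1 unless y = c; then c + d = h_i, against `hᵢ≢`. At l = i both
        -- summands exceed h_i.
        no-relation-hₗ : ∀ k l → l + k ≡ i → ∀ {a b} → a ∈ H → b ∈ H →
          h x l < a → h x l < b → a + b ≢ h x i + h x l
        no-relation-hₗ zero l l+0≡i _ _ hl<a hl<b a+b≡ =
          <-irrefl (sym a+b≡) (+-mono-< (subst (λ m → h x m < _) l≡i hl<a) hl<b)
          where
          l≡i : l ≡ i
          l≡i = trans (sym (+-identityʳ l)) l+0≡i
        no-relation-hₗ (suc k) l l+sk≡i {a} {b} a∈H b∈H hl<a hl<b a+b≡ =
          propagate (m≤n⇒m<n∨m≡n (≤-trans c≤a (m≤m+n a (b ∸ c))))
          where
          c d y : ℕ
          c = h x (suc l)
          d = x (suc l)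
          y = a + (b ∸ c)

          l<i : l < i
          l<i = subst (l <_) l+sk≡i (m<m+n l (s≤s z≤n))

          l<n : l < n
          l<n = ≤-trans l<i i≤n

          c≤a : c ≤ a
          c≤a = next l<n a∈H hl<a

          c≤b : c ≤ b
          c≤b = next l<n b∈H hl<b

          y∈H : y ∈ H
          y∈H = +∸-closed H-closed a∈H b∈H (h∈H l<n) c≤a c≤b

          y+d≡ : y + d ≡ h x i
          y+d≡ = +-cancelʳ-≡ (h x l) _ _ (begin
            y + d + h x l            ≡⟨ +-assoc y d (h x l) ⟩
            y + (d + h x l)          ≡⟨ cong (y +_) (trans (+-comm d (h x l)) (sym (h-suc x l))) ⟩
            y + c                    ≡⟨ +-assoc a (b ∸ c) c ⟩
            a + (b ∸ c + c)          ≡⟨ cong (a +_) (m∸n+n≡m c≤b) ⟩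
            a + b                    ≡⟨ a+b≡ ⟩
            h x i + h x l            ∎)
            where open ≡-Reasoning

          propagate : c < y ⊎ c ≡ y → ⊥
          propagate (inj₁ c<y) =
            no-relation-hₗ k (suc l) (trans (sym (+-suc l k)) l+sk≡i) y∈H c+d∈H c<y
              (m<m+n c d>0)
              (trans (cong (y +_) (+-comm c d))
                (trans (sym (+-assoc y d c)) (cong (_+ c) y+d≡)))
            where
            d>0 : 0 < d
            d>0 = positive (suc l) (s≤s z≤n) l<n

            c+d∈H : c + d ∈ H
            c+d∈H = subst (λ m → m + d ∈ H) (sym (h-suc x l))
              (double-closed H-closed (h x l) d (h∈H (<⇒≤ l<n))
                (subst H (h-suc x l) (h∈H l<n)))
          propagate (inj₂ c≡y) = hᵢ≢ sl<i c+d≡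
            where
            c+d≡ : c + d ≡ h x i
            c+d≡ = trans (cong (_+ d) c≡y) y+d≡

            -- If l + 1 = i, then c = h_i = c + d, against d > 0.
            sl<i : suc l < i
            sl<i = ≤∧≢⇒< l<i λ sl≡i → <-irrefl (trans (cong (h x) sl≡i) (sym c+d≡))
              (m<m+n c (positive (suc l) (s≤s z≤n) l<n))

        -- Either c = h_l with l ≤ i, or c is at least h_i and the sum a + b is too large.
        no-relation : ∀ {a b c} → a ∈ H → b ∈ H → c ∈ H → c < a → c < b →
          a + b ≢ h x i + c
        no-relation {a} {b} {c} a∈H b∈H c∈H c<a c<b a+b≡ with proj₁ elements c∈H
        ... | inj₂ hn<c = <-irrefl (sym a+b≡)
          (+-mono-< (≤-<-trans (h-mono-≤ x i≤n) (<-trans hn<c c<a)) c<b)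
        ... | inj₁ (l , _ , refl) with l ≤? i
        ...   | yes l≤i = no-relation-hₗ (i ∸ l) l (m+[n∸m]≡n l≤i) a∈H b∈H c<a c<b a+b≡
        ...   | no  l≰i = <-irrefl (sym a+b≡)
          (+-mono-< (≤-<-trans (h-mono-≤ x (<⇒≤ (≰⇒> l≰i))) c<a) c<b)

        -- At h_i, membership in K is membership in M, so H ⊆ K gives h_i ∈ M
        -- outright although M need not be decidable.
        K : Subset
        K m = m ∈ H × (m ≡ h x i → h x i ∈ M)

        -- Reaching h_i from K is a relation excluded by `no-relation`: a + b = h_i + 0 for sums, a
        -- + a = h_i + b for 2a - b. The exceptions, a zero summand and a = b, return an element
        -- already in K.
        K-isArf : 1 ≤ i → IsArf K
        K-isArf 1≤i = record
          { isNumericalSemigroup = record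
              { zero-mem         = 0-mem ,
                                   λ 0≡ → contradiction 0≡ (<⇒≢ (h-mono-< 1≤i i≤n))
              ; +-closed         = sums
              -- Whether h_i lies in M is undecided, so h_i is listed as a possible gap.
              ; finiteComplement = h x i ∷ proj₁ finiteComplement , listed
              }
          ; arf-closed = doubles
          }
          where
          open IsArfClosed H-closed
          open IsNumericalSemigroup (IsArf.isNumericalSemigroup H-arf)
            using (finiteComplement)

          sums : ∀ {a b} → a ∈ K → b ∈ K → a + b ∈ K
          sums {zero}  {b}     _ b∈K = b∈K
          sums {suc a} {zero}  a∈K _ = subst K (sym (+-identityʳ (suc a))) a∈K
          sums {suc a} {suc b} (a∈H , _) (b∈H , _) = sum-closed a∈H b∈H , λ a+b≡ →
            contradiction (trans a+b≡ (sym (+-identityʳ (h x i))))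
              (no-relation a∈H b∈H 0-mem (s≤s z≤n) (s≤s z≤n))

          doubles : ∀ {a b} → a ∈ K → b ∈ K → b ≤ a → 2 * a ∸ b ∈ K
          doubles {a} {b} (a∈H , a∈K) (b∈H , _) b≤a with m≤n⇒m<n∨m≡n b≤a
          ... | inj₂ refl = arf-closed a∈H b∈H b≤a ,
            λ eq → a∈K (trans (sym (trans (m+n∸m≡n a (a + 0)) (+-identityʳ a))) eq)
          ... | inj₁ b<a  = arf-closed a∈H b∈H b≤a , λ eq →
            contradiction
              (begin
                a + a              ≡⟨ cong (a +_) (+-identityʳ a) ⟨
                2 * a              ≡⟨ m∸n+n≡m (≤-trans b≤a (m≤m+n a _)) ⟨
                2 * a ∸ b + b      ≡⟨ cong (_+ b) eq ⟩
                h x i + b          ∎)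
              (no-relation a∈H a∈H b∈H b<a b<a)
            where open ≡-Reasoning

          listed : ∀ m → m ∈ K ⊎ _
          listed m with m ≟ h x i
          ... | yes m≡ = inj₂ (here m≡)
          ... | no  m≢ with proj₂ finiteComplement m
          ...   | inj₁ m∈H = inj₁ (m∈H , λ m≡ → contradiction m≡ m≢)
          ...   | inj₂ m∈C = inj₂ (there m∈C)

        hᵢ∈M : 1 ≤ i → h x i ∈ M
        hᵢ∈M 1≤i = proj₂ (least (K-isArf 1≤i) M⊆K (h∈H i≤n)) refl
          where
          M⊆K : M ⊆ K
          M⊆K m∈M = M⊆H m∈M , λ m≡ → subst M m≡ m∈M

theorem4p3 : (H : Subset) → IsArf H → H ⊂ U →
    (n : ℕ) (x : ℕ → ℕ) → IsPresentation H n x →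
    (i : ℕ) → 1 ≤ i → i ≤ n →
    (M : Subset) → IsMinimalArfSystem M H →
    h x i ∈ M ⇔ (∀ j → 1 ≤ j → j < i → x j ≢ sumIoc x j i)
theorem4p3 H H-arf _ n x pres i 1≤i i≤n M M-min = mk⇔
  (λ { hᵢ∈M (suc j) _ sj<i xj≡ →
         minimal (M∖hᵢ isArfSystem i≤n)
           (proj₁ , λ M⊆Y → proj₂ (M⊆Y hᵢ∈M) refl)
           (Redundant.isArfSystem isArfSystem i≤n sj<i xj≡) })
  (λ x≢ → Irredundant.hᵢ∈M isArfSystem i≤n x≢ 1≤i)
  where
  open IsMinimalArfSystem M-min
  open Presented H-arf pres
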